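{- Fix an integer $k\ge0$ and let $f(x)=\sum_{P\in\mathcal{N}_k}x^{\mathrm{size}(P)}$. Then \[ \Phi\big(f(x)\big)=\sum_{P\in\mathcal{N}_k}x^{\mathrm{size}(P)}y^{\mathrm{pa}(P)}, \] where $\mathrm{pa}(P)$ is the number of pyramid ascents of $P$.
   Context: The run transform is $\Phi\big(f(x)\big)=\frac{1-x}{1-xy}\,f\!\left(\frac{x(1-x)}{1-xy}\right)$. A $U$-$D$ path is a lattice path of upsteps $U=(1,1)$ and downsteps $D=(1,-1)$. $\mathcal{N}_k$ is the set of $U$-$D$ paths with $n$ upsteps and $n+k$ downsteps for some $n\ge0$ that never go below the horizontal line through the terminal vertex. The size of a path is its number of downsteps. An ascent is a maximal subpath of the form $U^i$ ($i\ge1$); a pyramid is a maximal subpath of the form $U^iD^i$ ($i\ge1$); a pyramid ascent is an ascent that is the first half of a pyramid. -}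

module Defs where

open import Data.Nat as ℕ using (ℕ; zero; suc; _∸_; _≤ᵇ_; _≡ᵇ_)
open import Data.Integer as ℤ using (ℤ; +_; _≤ᵇ_)
open import Data.Bool using (Bool; true; false; _∧_; if_then_else_)
open import Data.List using (List; []; _∷_; length; filter; drop; map; concatMap)
open import Relation.Nullary.Decidable using (does)
open import Relation.Binary.PropositionalEquality using (_≡_)
open import Data.Bool.Properties using (T?)

-- Formal power series with integer coefficients.
-- PS1 : univariate in x, PS1 f n = [x^n] f.
-- PS2 : bivariate in x,y, PS2 F m j = [x^m y^j] F.

PS1 : Set
PS1 = ℕ → ℤ

PS2 : Set
PS2 = ℕ → ℕ → ℤ

Σ≤ : ℕ → (ℕ → ℤ) → ℤ
Σ≤ zero    g = g zero
Σ≤ (suc n) g = Σ≤ n g ℤ.+ g (suc n)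

oneS : PS2
oneS zero zero = + 1
oneS _    _    = + 0

X : PS2
X (suc zero) zero = + 1
X _          _    = + 0

Y : PS2
Y zero (suc zero) = + 1
Y _    _          = + 0

_⊕_ : PS2 → PS2 → PS2
(F ⊕ G) m j = F m j ℤ.+ G m j

_⊖_ : PS2 → PS2 → PS2
(F ⊖ G) m j = F m j ℤ.- G m j

_⊗_ : PS2 → PS2 → PS2
(F ⊗ G) m j = Σ≤ m λ a → Σ≤ j λ b → F a b ℤ.* G (m ∸ a) (j ∸ b)

infixl 6 _⊕_ _⊖_
infixl 7 _⊗_

_^S_ : PS2 → ℕ → PS2
F ^S zero  = oneS
F ^S suc n = F ⊗ (F ^S n)

-- Composition f(G) of a univariate series f with a bivariate series G
-- having no x^0 terms (so G^n has only terms x^m with m ≥ n and the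
-- coefficient sum is finite):  [x^m y^j] f(G) = Σ_{n ≤ m} f_n [x^m y^j] G^n.
compose : PS1 → PS2 → PS2
compose f G m j = Σ≤ m λ n → f n ℤ.* (G ^S n) m j

-- Geometric series 1/(1-U) = Σ_k U^k for U having no x^0 terms.
geom : PS2 → PS2
geom U m j = Σ≤ m λ n → (U ^S n) m j

Φ : PS1 → PS2
Φ f = ((oneS ⊖ X) ⊗ geom (X ⊗ Y)) ⊗ compose f (X ⊗ (oneS ⊖ X) ⊗ geom (X ⊗ Y))

data Step : Set where
  U D : Step

isD : Step → Bool
isD U = false
isD D = true

numU numD : List Step → ℕ
numU []      = 0
numU (U ∷ s) = suc (numU s)
numU (D ∷ s) = numU s
numD []      = 0
numD (U ∷ s) = numD s
numD (D ∷ s) = suc (numD s)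

size : List Step → ℕ
size = numD

aboveB : ℤ → ℤ → List Step → Bool
aboveB k h []      = true
aboveB k h (U ∷ s) = aboveB k (h ℤ.+ + 1) s
aboveB k h (D ∷ s) = (ℤ.- k ℤ.≤ᵇ (h ℤ.- + 1)) ∧ aboveB k (h ℤ.- + 1) s

-- P ∈ 𝒩_k : n upsteps, n+k downsteps, and never below the horizontal
-- line through the terminal vertex (height -k relative to the start)
inN : ℕ → List Step → Bool
inN k p = ((numU p ℕ.+ k) ≡ᵇ numD p) ∧ aboveB (+ k) (+ 0) p

leadU leadD : List Step → ℕ
leadU (U ∷ s) = suc (leadU s)
leadU _       = 0
leadD (D ∷ s) = suc (leadD s)
leadD _       = 0

pyrPrefix : List Step → Bool
pyrPrefix s = (1 ℕ.≤ᵇ leadU s) ∧ (leadU s ℕ.≤ᵇ leadD (drop (leadU s) s))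

-- pa(P): number of pyramid ascents, i.e. ascents (maximal U-runs, so
-- starting at the beginning or right after a D) which are the first half
-- of a pyramid U^i D^i.
paGo : Bool → List Step → ℕ
paGo b []      = 0
paGo b (x ∷ s) = (if b ∧ pyrPrefix (x ∷ s) then 1 else 0) ℕ.+ paGo (isD x) s

pa : List Step → ℕ
pa = paGo true

pathsOfLength : ℕ → List (List Step)
pathsOfLength zero    = [] ∷ []
pathsOfLength (suc L) = concatMap (λ s → (U ∷ s) ∷ (D ∷ s) ∷ []) (pathsOfLength L)

countUpTo : ℕ → (List Step → Bool) → ℕ
countUpTo zero    P = length (filter (λ p → T? (P p)) (pathsOfLength zero))
countUpTo (suc L) P = countUpTo L P ℕ.+ length (filter (λ p → T? (P p)) (pathsOfLength (suc L)))

-- f(x) = Σ_{P ∈ 𝒩_k} x^{size P}; a path of size n has length ≤ 2n.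
fN : ℕ → PS1
fN k n = + countUpTo (2 ℕ.* n) (λ p → inN k p ∧ (size p ≡ᵇ n))

gN : ℕ → PS2
gN k m j = + countUpTo (2 ℕ.* m) (λ p → inN k p ∧ (size p ≡ᵇ m) ∧ (pa p ≡ᵇ j))

{-# OPTIONS --safe #-}

-- For paths from height h to 0 staying weakly above 0, let T_h count all pyramid
-- ascents and F_h all but an initial one.  An initial pyramid ascent comes from a
-- prefix UⁱDⁱ, and what follows it is again counted by T_h, so
-- T_h = F_h + (y − 1) (x + x² + …) T_h, that is T_h = c F_h with c = (1 − x)/(1 − xy).
-- Splitting off the first step, F_h = [h = 0] + F_{h+1} + x c F_{h−1}; at y = 1 this is
-- the recursion of the univariate series f_h with x replaced by x c.  The recursion has
-- a unique solution with F_h divisible by x^h, so F_h = f_h(x c) and T_k = c f_k(x c).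
module Submission where

open import Defs
open import Data.Nat as ℕ using (ℕ; zero; suc; _∸_; _≤ᵇ_; _≡ᵇ_; _≤_; _<_; z≤n; s≤s)
import Data.Nat.Properties as ℕ
import Data.Nat.Tactic.RingSolver as ℕSolver
open import Data.Integer as ℤ using (ℤ; +_; 0ℤ; 1ℤ; _+_; _*_; _-_; -_)
import Data.Integer.Properties as ℤ
open import Data.Integer.Tactic.RingSolver using (solve-∀)
open import Data.Bool using (Bool; true; false; T; _∧_; if_then_else_)
open import Data.Bool.Properties using (T?; ∧-assoc; ∧-zeroʳ; ∧-identityʳ)
open import Data.List using (List; []; _∷_; length; filter; concatMap; drop)
open import Data.Empty using (⊥-elim)
open import Function using (_∘_)
open import Relation.Binary.PropositionalEquality
  using (_≡_; refl; sym; trans; cong; cong₂; subst; subst₂; module ≡-Reasoning)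

open ≡-Reasoning

-- Weighted path sums and their first-step decomposition.

-- Multiplication by xy; on the indices (height, size) it also describes a downstep.
diag : PS2 → PS2
diag F (suc m) (suc j) = F m j
diag F _       _       = 0ℤ

diag-cong : ∀ {F G} → (∀ m j → F m j ≡ G m j) → ∀ m j → diag F m j ≡ diag G m j
diag-cong F≗G zero    j       = refl
diag-cong F≗G (suc m) zero    = refl
diag-cong F≗G (suc m) (suc j) = F≗G m j

diag-zero : ∀ {F} → (∀ m j → F m j ≡ 0ℤ) → ∀ m j → diag F m j ≡ 0ℤ
diag-zero F≗0 zero    j       = refl
diag-zero F≗0 (suc m) zero    = refl
diag-zero F≗0 (suc m) (suc j) = F≗0 m j

diag-+ : ∀ F G m j → diag (F ⊕ G) m j ≡ diag F m j + diag G m j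
diag-+ F G zero    j       = refl
diag-+ F G (suc m) zero    = refl
diag-+ F G (suc m) (suc j) = refl

-- The sum of e over the paths of length at most L with m downsteps that go
-- from height h to height 0 and stay weakly above 0.
pathSum : ℕ → ℕ → ℕ → (List Step → ℤ) → ℤ
pathSum zero    h m e = oneS h m * e []
pathSum (suc L) h m e = oneS h m * e [] +
  (pathSum L (suc h) m (e ∘ (U ∷_)) +
   diag (λ h′ m′ → pathSum L h′ m′ (e ∘ (D ∷_))) h m)

pathSum-cong : ∀ L h m {e e′} → (∀ s → e s ≡ e′ s) → pathSum L h m e ≡ pathSum L h m e′
pathSum-cong zero    h m e≗e′ = cong (oneS h m *_) (e≗e′ [])
pathSum-cong (suc L) h m e≗e′ = cong₂ _+_ (cong (oneS h m *_) (e≗e′ []))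
  (cong₂ _+_ (pathSum-cong L (suc h) m (e≗e′ ∘ (U ∷_)))
    (diag-cong (λ h′ m′ → pathSum-cong L h′ m′ (e≗e′ ∘ (D ∷_))) h m))

pathSum-zero : ∀ L h m → pathSum L h m (λ _ → 0ℤ) ≡ 0ℤ
pathSum-zero zero    h m = ℤ.*-zeroʳ (oneS h m)
pathSum-zero (suc L) h m = cong₂ _+_ (ℤ.*-zeroʳ (oneS h m))
  (cong₂ _+_ (pathSum-zero L (suc h) m) (diag-zero (pathSum-zero L) h m))

pathSum-+ : ∀ L h m e e′ →
  pathSum L h m (λ s → e s + e′ s) ≡ pathSum L h m e + pathSum L h m e′
pathSum-+ zero    h m e e′ = ℤ.*-distribˡ-+ (oneS h m) (e []) (e′ [])
pathSum-+ (suc L) h m e e′ = begin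
  o * (e [] + e′ []) + (pathSum L (suc h) m (λ s → e (U ∷ s) + e′ (U ∷ s)) +
    diag (λ h m → pathSum L h m (λ s → e (D ∷ s) + e′ (D ∷ s))) h m)
    ≡⟨ cong (λ x → o * (e [] + e′ []) + x) (cong₂ _+_ (pathSum-+ L (suc h) m (e ∘ (U ∷_)) (e′ ∘ (U ∷_)))
         (trans (diag-cong (λ h m → pathSum-+ L h m _ _) h m)
                (diag-+ (dn e) (dn e′) h m))) ⟩
  o * (e [] + e′ []) + ((up e + up e′) + (diag (dn e) h m + diag (dn e′) h m))
    ≡⟨ regroup o (e []) (e′ []) (up e) (up e′) (diag (dn e) h m) (diag (dn e′) h m) ⟩
  (o * e [] + (up e + diag (dn e) h m)) + (o * e′ [] + (up e′ + diag (dn e′) h m)) ∎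
  where
  o : ℤ
  o = oneS h m
  up : (List Step → ℤ) → ℤ
  up e = pathSum L (suc h) m (e ∘ (U ∷_))
  dn : (List Step → ℤ) → PS2
  dn e h m = pathSum L h m (e ∘ (D ∷_))
  regroup : ∀ o x y a b c d →
    o * (x + y) + ((a + b) + (c + d)) ≡ (o * x + (a + c)) + (o * y + (b + d))
  regroup = solve-∀

pathSum-vanish : ∀ L {h m} e → m < h → pathSum L h m e ≡ 0ℤ
pathSum-vanish zero    {suc h} e m<h = refl
pathSum-vanish (suc L) {suc h} {zero} e m<h =
  trans (ℤ.+-identityˡ _) (cong (_+ 0ℤ) (pathSum-vanish L _ (s≤s z≤n)))
pathSum-vanish (suc L) {suc h} {suc m} e (s≤s m<h) =
  trans (ℤ.+-identityˡ _)
    (cong₂ _+_ (pathSum-vanish L _ (s≤s (ℕ.m≤n⇒m≤1+n m<h))) (pathSum-vanish L _ m<h))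

2*suc : ∀ m → 2 ℕ.* suc m ≡ suc (suc (2 ℕ.* m))
2*suc m = ℕ.*-suc 2 m

-- A path from height h with m downsteps has length 2m − h.
pathSum-stable : ∀ L h m e → 2 ℕ.* m ≤ L ℕ.+ h → pathSum (suc L) h m e ≡ pathSum L h m e
pathSum-stable zero zero    zero    e _ = ℤ.+-identityʳ _
pathSum-stable zero (suc h) zero    e _ = refl
pathSum-stable zero (suc h) (suc m) e p rewrite 2*suc m with s≤s q ← p =
  cong (λ x → 0ℤ + (0ℤ + x)) (pathSum-vanish zero {h} {m} (e ∘ (D ∷_)) (ℕ.≤-trans (s≤s (ℕ.m≤m+n m _)) q))
-- An upstep moves one unit from the length bound to the height, and a downstep lowers both sides of
-- the inequality by two, so the hypothesis persists.
pathSum-stable (suc L) h m e p =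
  cong (λ x → oneS h m * e [] + x) (cong₂ _+_
    (pathSum-stable L (suc h) m (e ∘ (U ∷_)) (subst (2 ℕ.* m ≤_) (sym (ℕ.+-suc L h)) p))
    (down h m p))
  where
  down : ∀ h m → 2 ℕ.* m ≤ suc L ℕ.+ h →
    diag (λ h′ m′ → pathSum (suc L) h′ m′ (e ∘ (D ∷_))) h m ≡
    diag (λ h′ m′ → pathSum L h′ m′ (e ∘ (D ∷_))) h m
  down zero    m       p = refl
  down (suc h) zero    p = refl
  down (suc h) (suc m) p rewrite 2*suc m | ℕ.+-suc L h with s≤s (s≤s q) ← p =
    pathSum-stable L h m _ q

-- No path from height `h` to 0 with `m` downsteps is longer than `2 * m`, so the bound loses
-- nothing; it is also the bound in `fN` and `gN`.
pathTotal : ℕ → ℕ → (List Step → ℤ) → ℤ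
pathTotal h m = pathSum (2 ℕ.* m) h m

pathTotal-cong : ∀ h m {e e′} → (∀ s → e s ≡ e′ s) → pathTotal h m e ≡ pathTotal h m e′
pathTotal-cong h m = pathSum-cong (2 ℕ.* m) h m

-- For positive `m`, unfolding `pathSum` leaves the up branch with a length bound one too small and
-- the down branch with one too large; `pathSum-stable` repairs both.
pathTotal-step : ∀ h m e → pathTotal h m e ≡
  oneS h m * e [] + (pathTotal (suc h) m (e ∘ (U ∷_)) +
                     diag (λ h′ m′ → pathTotal h′ m′ (e ∘ (D ∷_))) h m)
pathTotal-step zero    zero    e = sym (ℤ.+-identityʳ _)
pathTotal-step (suc h) zero    e = refl
pathTotal-step h       (suc m) e = begin
  pathSum (2 ℕ.* suc m) h (suc m) e
    ≡⟨ cong (λ L → pathSum L h (suc m) e) (2*suc m) ⟩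
  pathSum (suc (suc (2 ℕ.* m))) h (suc m) e
    ≡⟨ cong (λ x → oneS h (suc m) * e [] + x) (cong₂ _+_ up (down h)) ⟩
  _ ∎
  where
  up : pathSum (suc (2 ℕ.* m)) (suc h) (suc m) (e ∘ (U ∷_)) ≡
       pathTotal (suc h) (suc m) (e ∘ (U ∷_))
  up = trans
    (sym (pathSum-stable (suc (2 ℕ.* m)) (suc h) (suc m) (e ∘ (U ∷_)) bound))
    (cong (λ L → pathSum L (suc h) (suc m) (e ∘ (U ∷_))) (sym (2*suc m)))
    where
    bound : 2 ℕ.* suc m ≤ suc (2 ℕ.* m) ℕ.+ suc h
    bound rewrite 2*suc m | ℕ.+-suc (2 ℕ.* m) h = s≤s (s≤s (ℕ.m≤m+n _ h))
  down : ∀ h →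
    diag (λ h′ m′ → pathSum (suc (2 ℕ.* m)) h′ m′ (e ∘ (D ∷_))) h (suc m) ≡
    diag (λ h′ m′ → pathTotal h′ m′ (e ∘ (D ∷_))) h (suc m)
  down zero    = refl
  down (suc h) = pathSum-stable (2 ℕ.* m) h m _ (ℕ.m≤m+n _ h)

pathTotal-vanish : ∀ {h m} e → m < h → pathTotal h m e ≡ 0ℤ
pathTotal-vanish {m = m} = pathSum-vanish (2 ℕ.* m)

-- From membership in 𝒩_k and list counts to path sums.

isPath : ℕ → ℕ → List Step → Bool
isPath h       m       []      = (h ≡ᵇ 0) ∧ (m ≡ᵇ 0)
isPath h       m       (U ∷ s) = isPath (suc h) m s
isPath (suc h) (suc m) (D ∷ s) = isPath h m s
isPath _       _       (D ∷ s) = false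

-- Measuring heights from the terminal line replaces the integer `z` of `aboveB` by a natural number
-- `h` with `z + k = h`, the invariant of `go`. The floor test on a downstep then fails exactly when
-- `h` is 0.
inN-size : ∀ k m s → inN k s ∧ (size s ≡ᵇ m) ≡ isPath k m s
inN-size k m s = go s k m 0ℤ (ℤ.+-identityˡ (+ k))
  where
  swap : ∀ z k x → z + x + k ≡ z + k + x
  swap = solve-∀
  restore : ∀ z k → z ≡ ((z + - 1ℤ) + k) + - k + 1ℤ
  restore = solve-∀
  floor-hit : ∀ z → z + + k ≡ 0ℤ → ((- (+ k)) ℤ.≤ᵇ (z - 1ℤ)) ≡ false
  floor-hit z eq with (- (+ k)) ℤ.≤ᵇ (z - 1ℤ) in b
  ... | false = refl
  -- Adding `k` to both sides of the assumed inequality would give 0 ≤ -1.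
  ... | true  with () ← subst₂ ℤ._≤_ (ℤ.+-inverseˡ (+ k))
    (trans (swap z (+ k) (- 1ℤ)) (cong (_- 1ℤ) eq))
    (ℤ.+-monoˡ-≤ (+ k) (ℤ.≤ᵇ⇒≤ { - (+ k)} {z - 1ℤ} (subst T (sym b) _)))
  floor-clear : ∀ h z → z + + k ≡ + suc h → ((- (+ k)) ℤ.≤ᵇ (z - 1ℤ)) ≡ true
  floor-clear h z eq with (- (+ k)) ℤ.≤ᵇ (z - 1ℤ) in b
  ... | true  = refl
  ... | false = ⊥-elim (subst T b (ℤ.≤⇒≤ᵇ (subst₂ ℤ._≤_ (ℤ.+-identityˡ (- (+ k))) back
    (ℤ.+-monoˡ-≤ (- (+ k)) (ℤ.+≤+ (z≤n {h}))))))
    where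
    cancel : ∀ z k → ((z + k) - 1ℤ) - k ≡ z - 1ℤ
    cancel = solve-∀
    back : + h - + k ≡ z - 1ℤ
    back = trans (cong (λ x → x - 1ℤ - + k) (sym eq)) (cancel z (+ k))
  go : ∀ s h m z → z + + k ≡ + h →
    (((numU s ℕ.+ h) ≡ᵇ numD s) ∧ aboveB (+ k) z s) ∧ (numD s ≡ᵇ m) ≡ isPath h m s
  go [] zero zero    z eq = refl
  go [] zero (suc m) z eq = refl
  go [] (suc h) m    z eq = refl
  go (U ∷ s) h m z eq rewrite sym (ℕ.+-suc (numU s) h) =
    go s (suc h) m (z + 1ℤ)
      (trans (swap z (+ k) 1ℤ) (trans (cong (_+ 1ℤ) eq) (cong +_ (ℕ.+-comm h 1))))
  go (D ∷ s) zero    m z eq rewrite floor-hit z eq =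
    cong (_∧ (suc (numD s) ≡ᵇ m)) (∧-zeroʳ _)
  go (D ∷ s) (suc h) zero z eq = ∧-zeroʳ _
  go (D ∷ s) (suc h) (suc m) z eq rewrite floor-clear h z eq | ℕ.+-suc (numU s) h =
    go s h m (z - 1ℤ) (trans (swap z (+ k) (- 1ℤ)) (cong (_- 1ℤ) eq))

count : List (List Step) → (List Step → Bool) → ℕ
count xs P = length (filter (λ p → T? (P p)) xs)

count-∷ : ∀ x xs P → count (x ∷ xs) P ≡ (if P x then 1 else 0) ℕ.+ count xs P
count-∷ x xs P with P x
... | true  = refl
... | false = refl

count-cong : ∀ xs {P Q} → (∀ p → P p ≡ Q p) → count xs P ≡ count xs Q
count-cong []       P≗Q = refl
count-cong (x ∷ xs) {P} {Q} P≗Q = begin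
  count (x ∷ xs) P
    ≡⟨ count-∷ x xs P ⟩
  (if P x then 1 else 0) ℕ.+ count xs P
    ≡⟨ cong₂ (λ b n → (if b then 1 else 0) ℕ.+ n) (P≗Q x) (count-cong xs P≗Q) ⟩
  (if Q x then 1 else 0) ℕ.+ count xs Q
    ≡⟨ count-∷ x xs Q ⟨
  count (x ∷ xs) Q ∎

count-extend : ∀ xs P →
  count (concatMap (λ s → (U ∷ s) ∷ (D ∷ s) ∷ []) xs) P ≡
  count xs (P ∘ (U ∷_)) ℕ.+ count xs (P ∘ (D ∷_))
count-extend []       P = refl
count-extend (x ∷ xs) P = begin
  count ((U ∷ x) ∷ (D ∷ x) ∷ ys) P
    ≡⟨ trans (count-∷ (U ∷ x) ((D ∷ x) ∷ ys) P) (cong (u ℕ.+_) (count-∷ (D ∷ x) ys P)) ⟩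
  u ℕ.+ (d ℕ.+ count ys P)
    ≡⟨ cong (λ n → u ℕ.+ (d ℕ.+ n)) (count-extend xs P) ⟩
  u ℕ.+ (d ℕ.+ (count xs (P ∘ (U ∷_)) ℕ.+ count xs (P ∘ (D ∷_))))
    ≡⟨ regroup u d (count xs (P ∘ (U ∷_))) (count xs (P ∘ (D ∷_))) ⟩
  (u ℕ.+ count xs (P ∘ (U ∷_))) ℕ.+ (d ℕ.+ count xs (P ∘ (D ∷_)))
    ≡⟨ cong₂ ℕ._+_ (count-∷ x xs (P ∘ (U ∷_))) (count-∷ x xs (P ∘ (D ∷_))) ⟨
  count (x ∷ xs) (P ∘ (U ∷_)) ℕ.+ count (x ∷ xs) (P ∘ (D ∷_)) ∎
  where
  ys : List (List Step)
  ys = concatMap (λ s → (U ∷ s) ∷ (D ∷ s) ∷ []) xs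
  u d : ℕ
  u = if P (U ∷ x) then 1 else 0
  d = if P (D ∷ x) then 1 else 0
  regroup : ∀ u d a b → u ℕ.+ (d ℕ.+ (a ℕ.+ b)) ≡ (u ℕ.+ a) ℕ.+ (d ℕ.+ b)
  regroup = ℕSolver.solve-∀

countUpTo-cong : ∀ L {P Q} → (∀ p → P p ≡ Q p) → countUpTo L P ≡ countUpTo L Q
countUpTo-cong zero    P≗Q = count-cong (pathsOfLength zero) P≗Q
countUpTo-cong (suc L) P≗Q =
  cong₂ ℕ._+_ (countUpTo-cong L P≗Q) (count-cong (pathsOfLength (suc L)) P≗Q)

-- `countUpTo` grows by length, whereas `pathSum` recurses on the first step; since `pathsOfLength`
-- prepends steps, every nonempty list can be sorted by its head.
countUpTo-step : ∀ L P → countUpTo (suc L) P ≡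
  countUpTo 0 P ℕ.+ (countUpTo L (P ∘ (U ∷_)) ℕ.+ countUpTo L (P ∘ (D ∷_)))
countUpTo-step zero    P = cong (countUpTo 0 P ℕ.+_) (count-extend ([] ∷ []) P)
countUpTo-step (suc L) P = begin
  countUpTo (suc L) P ℕ.+ count (pathsOfLength (suc (suc L))) P
    ≡⟨ cong₂ ℕ._+_ (countUpTo-step L P) (count-extend (pathsOfLength (suc L)) P) ⟩
  (c ℕ.+ (u ℕ.+ d)) ℕ.+ (u′ ℕ.+ d′)
    ≡⟨ regroup c u d u′ d′ ⟩
  c ℕ.+ ((u ℕ.+ u′) ℕ.+ (d ℕ.+ d′)) ∎
  where
  c u d u′ d′ : ℕ
  c = countUpTo 0 P
  u = countUpTo L (P ∘ (U ∷_))
  d = countUpTo L (P ∘ (D ∷_))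
  u′ = count (pathsOfLength (suc L)) (P ∘ (U ∷_))
  d′ = count (pathsOfLength (suc L)) (P ∘ (D ∷_))
  regroup : ∀ c u d u′ d′ →
    (c ℕ.+ (u ℕ.+ d)) ℕ.+ (u′ ℕ.+ d′) ≡ c ℕ.+ ((u ℕ.+ u′) ℕ.+ (d ℕ.+ d′))
  regroup = ℕSolver.solve-∀

countUpTo-false : ∀ L → countUpTo L (λ _ → false) ≡ 0
countUpTo-false zero    = refl
countUpTo-false (suc L) = trans (countUpTo-step L (λ _ → false))
  (cong₂ ℕ._+_ (countUpTo-false L) (countUpTo-false L))

indicator : Bool → ℤ
indicator b = if b then 1ℤ else 0ℤ

countUpTo-0-isPath : ∀ h m (P : List Step → Bool) →
  + countUpTo 0 (λ s → isPath h m s ∧ P s) ≡ oneS h m * indicator (P [])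
countUpTo-0-isPath zero    zero    P with P []
... | true  = refl
... | false = refl
countUpTo-0-isPath zero    (suc m) P = refl
countUpTo-0-isPath (suc h) m       P = refl

countUpTo-isPath : ∀ L h m (P : List Step → Bool) →
  + countUpTo L (λ s → isPath h m s ∧ P s) ≡ pathSum L h m (indicator ∘ P)
countUpTo-isPath zero    h m P = countUpTo-0-isPath h m P
countUpTo-isPath (suc L) h m P = begin
  + countUpTo (suc L) (λ s → isPath h m s ∧ P s)
    ≡⟨ cong +_ (countUpTo-step L _) ⟩
  + countUpTo 0 (λ s → isPath h m s ∧ P s) +
    (+ countUpTo L (λ s → isPath (suc h) m s ∧ P (U ∷ s)) +
     + countUpTo L (λ s → isPath h m (D ∷ s) ∧ P (D ∷ s)))
    ≡⟨ cong₂ _+_ (countUpTo-0-isPath h m P)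
         (cong₂ _+_ (countUpTo-isPath L (suc h) m _) (down h m)) ⟩
  _ ∎
  where
  down : ∀ h m → + countUpTo L (λ s → isPath h m (D ∷ s) ∧ P (D ∷ s)) ≡
    diag (λ h′ m′ → pathSum L h′ m′ (indicator ∘ P ∘ (D ∷_))) h m
  -- Where a downstep is impossible, `isPath` rejects every continuation and the predicate computes
  -- to `false`.
  down zero    m       = cong +_ (countUpTo-false L)
  down (suc h) zero    = cong +_ (countUpTo-false L)
  down (suc h) (suc m) = countUpTo-isPath L h m _

gN-pathTotal : ∀ k m j → gN k m j ≡ pathTotal k m (λ s → indicator (pa s ≡ᵇ j))
gN-pathTotal k m j = trans
  (cong +_ (countUpTo-cong (2 ℕ.* m) λ s →
    trans (sym (∧-assoc (inN k s) (size s ≡ᵇ m) (pa s ≡ᵇ j)))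
          (cong (_∧ (pa s ≡ᵇ j)) (inN-size k m s))))
  (countUpTo-isPath (2 ℕ.* m) k m _)

fN-pathTotal : ∀ k n → fN k n ≡ pathTotal k n (λ _ → 1ℤ)
fN-pathTotal k n = trans
  (cong +_ (countUpTo-cong (2 ℕ.* n) λ s →
    trans (inN-size k n s) (sym (∧-identityʳ _))))
  (countUpTo-isPath (2 ℕ.* n) k n (λ _ → true))

-- Paths with a leading pyramid ascent.

pathTotal-zero : ∀ h m → pathTotal h m (λ _ → 0ℤ) ≡ 0ℤ
pathTotal-zero h m = pathSum-zero (2 ℕ.* m) h m

-- Whether the first ascent of Uⁱs, for i ≥ 1, is a pyramid ascent.
pyramidAfter : ℕ → List Step → Bool
pyramidAfter i s = (i ℕ.+ leadU s) ≤ᵇ leadD (drop (leadU s) s)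

-- Here `s` is the rest of a path: in `pyramidTerm` after `i` upsteps of its first ascent, in
-- `descentTerm` with `i` downsteps still needed to complete the leading pyramid. `φ` receives the
-- number of pyramid ascents other than the leading one. In the sums built from these terms, `h` is
-- the height of the pyramid's base.
pyramidTerm descentTerm : ℕ → (ℕ → ℤ) → List Step → ℤ
pyramidTerm i φ s = if pyramidAfter i s then φ (paGo false s) else 0ℤ
descentTerm i φ s = if i ≤ᵇ leadD s then φ (paGo true s) else 0ℤ

pyramidSum descentSum : ℕ → (ℕ → ℤ) → ℕ → ℕ → ℤ
pyramidSum i φ h m = pathTotal (i ℕ.+ h) m (pyramidTerm i φ)
descentSum i φ h m = pathTotal (i ℕ.+ h) m (descentTerm i φ)

suc-≤ᵇ-suc : ∀ i d → (suc i ≤ᵇ suc d) ≡ (i ≤ᵇ d)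
suc-≤ᵇ-suc zero    d = refl
suc-≤ᵇ-suc (suc i) d = refl

-- Requiring `suc i` leading downsteps kills the up branch, and deleting the forced `D` leaves the
-- value of `paGo true` unchanged.
descentSum-suc : ∀ i φ h m → descentSum (suc i) φ h (suc m) ≡ descentSum i φ h m
descentSum-suc i φ h m = begin
  descentSum (suc i) φ h (suc m)
    ≡⟨ pathTotal-step (suc i ℕ.+ h) (suc m) (descentTerm (suc i) φ) ⟩
  0ℤ + (pathTotal (suc (suc i) ℕ.+ h) (suc m) (λ _ → 0ℤ) +
        pathTotal (i ℕ.+ h) m (descentTerm (suc i) φ ∘ (D ∷_)))
    ≡⟨ cong₂ (λ x y → 0ℤ + (x + y)) (pathTotal-zero (suc (suc i) ℕ.+ h) (suc m))
         (pathTotal-cong (i ℕ.+ h) m λ s →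
           cong (λ b → if b then φ (paGo true s) else 0ℤ) (suc-≤ᵇ-suc i (leadD s))) ⟩
  0ℤ + (0ℤ + descentSum i φ h m)
    ≡⟨ trans (ℤ.+-identityˡ _) (ℤ.+-identityˡ _) ⟩
  descentSum i φ h m ∎

-- The first ascent either continues with `U` or ends with a `D`, which leaves `i` downsteps to
-- complete the pyramid.
pyramidSum-step : ∀ i φ h m →
  pyramidSum (suc i) φ h (suc m) ≡ pyramidSum (suc (suc i)) φ h (suc m) + descentSum i φ h m
pyramidSum-step i φ h m = begin
  pyramidSum (suc i) φ h (suc m)
    ≡⟨ pathTotal-step (suc i ℕ.+ h) (suc m) (pyramidTerm (suc i) φ) ⟩
  0ℤ + (pathTotal (suc (suc i) ℕ.+ h) (suc m) (pyramidTerm (suc i) φ ∘ (U ∷_)) +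
        pathTotal (i ℕ.+ h) m (pyramidTerm (suc i) φ ∘ (D ∷_)))
    ≡⟨ ℤ.+-identityˡ _ ⟩
  pathTotal (suc (suc i) ℕ.+ h) (suc m) (pyramidTerm (suc i) φ ∘ (U ∷_)) +
  pathTotal (i ℕ.+ h) m (pyramidTerm (suc i) φ ∘ (D ∷_))
    ≡⟨ cong₂ _+_
         (pathTotal-cong (suc (suc i) ℕ.+ h) (suc m) λ s →
           cong (λ n → if n ≤ᵇ leadD (drop (leadU s) s) then φ (paGo false s) else 0ℤ)
             (ℕ.+-suc (suc i) (leadU s)))
         (pathTotal-cong (i ℕ.+ h) m λ s →
           cong (λ b → if b then φ (paGo true s) else 0ℤ)
             (trans (cong (_≤ᵇ suc (leadD s)) (ℕ.+-identityʳ (suc i)))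
                    (suc-≤ᵇ-suc i (leadD s)))) ⟩
  pyramidSum (suc (suc i)) φ h (suc m) + descentSum i φ h m ∎

pyramidSum-vanish : ∀ i φ h {m} → m < i → pyramidSum i φ h m ≡ 0ℤ
pyramidSum-vanish i φ h m<i = pathTotal-vanish _ (ℕ.≤-trans m<i (ℕ.m≤m+n i h))

-- Bijectively, one `U` and one `D` are deleted from the leading pyramid. The proof unrolls
-- `pyramidSum-step` on both sides and matches the descent sums by `descentSum-suc`.
pyramidSum-suc : ∀ i φ h m → pyramidSum (suc (suc i)) φ h (suc m) ≡ pyramidSum (suc i) φ h m
pyramidSum-suc i φ h m = go m i m (ℕ.m≤n+m (suc m) i)
  where
  -- `d` bounds how far the ascent can still grow: at `d = 0` the hypothesis says `m ≤ i`, and both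
  -- sides vanish for lack of downsteps.
  go : ∀ d i m → m < i ℕ.+ suc d →
    pyramidSum (suc (suc i)) φ h (suc m) ≡ pyramidSum (suc i) φ h m
  both-vanish : ∀ i m → m < suc i →
    pyramidSum (suc (suc i)) φ h (suc m) ≡ pyramidSum (suc i) φ h m
  both-vanish i m m<i = trans (pyramidSum-vanish (suc (suc i)) φ h (s≤s m<i))
    (sym (pyramidSum-vanish (suc i) φ h m<i))
  go d       i zero    _ = both-vanish i zero (s≤s z≤n)
  go zero    i (suc m) p = both-vanish i (suc m) (subst (suc m <_) (ℕ.+-comm i 1) p)
  go (suc d) i (suc m) p = begin
    pyramidSum (suc (suc i)) φ h (suc (suc m))
      ≡⟨ pyramidSum-step (suc i) φ h (suc m) ⟩
    pyramidSum (suc (suc (suc i))) φ h (suc (suc m)) + descentSum (suc i) φ h (suc m)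
      ≡⟨ cong₂ _+_ (go d (suc i) (suc m) (subst (suc m <_) (ℕ.+-suc i (suc d)) p))
           (descentSum-suc i φ h m) ⟩
    pyramidSum (suc (suc i)) φ h (suc m) + descentSum i φ h m
      ≡⟨ pyramidSum-step i φ h m ⟨
    pyramidSum (suc i) φ h (suc m) ∎

-- Comparing the counts with and without the leading pyramid ascent.

-- With b = false an initial ascent is not counted.
paSum : Bool → (ℕ → ℤ) → ℕ → ℕ → ℤ
paSum b ψ h m = pathTotal h m (ψ ∘ paGo b)

-- When `ψ` extracts a coefficient in y, precomposition with `suc` is multiplication by y, so `Δ` is
-- the factor y - 1.
Δ : (ℕ → ℤ) → ℕ → ℤ
Δ ψ a = ψ (suc a) - ψ a

-- The two counts differ, by one, exactly when the path starts with a pyramid ascent. This forces a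
-- first step `U`, so only the up branch of the first-step decomposition survives.
paSum-split : ∀ ψ h m →
  paSum true ψ h m ≡ paSum false ψ h m + pyramidSum 1 (Δ ψ) h m
paSum-split ψ h m = begin
  pathTotal h m (ψ ∘ paGo true)
    ≡⟨ pathTotal-cong h m split ⟩
  pathTotal h m (λ s → ψ (paGo false s) + leading s)
    ≡⟨ pathSum-+ (2 ℕ.* m) h m _ leading ⟩
  paSum false ψ h m + pathTotal h m leading
    ≡⟨ cong (λ x → paSum false ψ h m + x) (pathTotal-step h m leading) ⟩
  paSum false ψ h m + (oneS h m * 0ℤ +
    (pyramidSum 1 (Δ ψ) h m + diag (λ h m → pathTotal h m (λ _ → 0ℤ)) h m))
    ≡⟨ cong (λ x → paSum false ψ h m + x) (cong₂ _+_ (ℤ.*-zeroʳ (oneS h m))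
         (cong (λ x → pyramidSum 1 (Δ ψ) h m + x) (diag-zero pathTotal-zero h m))) ⟩
  paSum false ψ h m + (0ℤ + (pyramidSum 1 (Δ ψ) h m + 0ℤ))
    ≡⟨ cong (λ x → paSum false ψ h m + x) (trans (ℤ.+-identityˡ _) (ℤ.+-identityʳ _)) ⟩
  paSum false ψ h m + pyramidSum 1 (Δ ψ) h m ∎
  where
  leading : List Step → ℤ
  leading s = if pyrPrefix s then Δ ψ (paGo false s) else 0ℤ
  add-sub : ∀ a b → a ≡ b + (a - b)
  add-sub = solve-∀
  split : ∀ s → ψ (paGo true s) ≡ ψ (paGo false s) + leading s
  split []      = sym (ℤ.+-identityʳ _)
  split (x ∷ s) with pyrPrefix (x ∷ s)
  ... | true  = add-sub (ψ (suc (paGo (isD x) s))) (ψ (paGo (isD x) s))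
  ... | false = sym (ℤ.+-identityʳ _)

paSum-zero : ∀ ψ h → paSum true ψ h 0 ≡ paSum false ψ h 0
paSum-zero ψ h = trans (paSum-split ψ h 0)
  (trans (cong (λ x → paSum false ψ h 0 + x) (pyramidSum-vanish 1 (Δ ψ) h (s≤s z≤n))) (ℤ.+-identityʳ _))

-- This is (1 - xy) T = (1 - x) F read at x-degree `suc m`, with `ψ ∘ suc` in the role of the factor
-- y.
paSum-suc : ∀ ψ h m → paSum true ψ h (suc m) ≡
  paSum false ψ h (suc m) - paSum false ψ h m + paSum true (ψ ∘ suc) h m
paSum-suc ψ h m = begin
  paSum true ψ h (suc m)
    ≡⟨ paSum-split ψ h (suc m) ⟩
  f′ + pyramidSum 1 (Δ ψ) h (suc m)
    -- `descentSum 0` asks for no downsteps, so it is `paSum true` by computation.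
    ≡⟨ cong (λ x → f′ + x) (pyramidSum-step 0 (Δ ψ) h m) ⟩
  f′ + (pyramidSum 2 (Δ ψ) h (suc m) + paSum true (Δ ψ) h m)
    -- Leading pyramids of height at least 2 at `suc m` correspond to all leading pyramids at `m`;
    -- this sums x + x² + ... without expanding it.
    ≡⟨ cong (λ x → f′ + (x + paSum true (Δ ψ) h m)) (pyramidSum-suc 0 (Δ ψ) h m) ⟩
  f′ + (p + paSum true (Δ ψ) h m)
    ≡⟨ cancel f′ f p (paSum true (Δ ψ) h m) ⟩
  f′ - f + (paSum true (Δ ψ) h m + (f + p))
    ≡⟨ cong (λ x → f′ - f + (paSum true (Δ ψ) h m + x)) (paSum-split ψ h m) ⟨
  f′ - f + (paSum true (Δ ψ) h m + paSum true ψ h m)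
    ≡⟨ cong (λ x → f′ - f + x) (pathSum-+ (2 ℕ.* m) h m _ _) ⟨
  f′ - f + pathTotal h m (λ s → Δ ψ (paGo true s) + ψ (paGo true s))
    ≡⟨ cong (λ x → f′ - f + x) (pathTotal-cong h m λ s → sub-add (ψ (suc (paGo true s))) (ψ (paGo true s))) ⟩
  f′ - f + paSum true (ψ ∘ suc) h m ∎
  where
  f f′ p : ℤ
  f = paSum false ψ h m
  f′ = paSum false ψ h (suc m)
  p = pyramidSum 1 (Δ ψ) h m
  cancel : ∀ a b c d → a + (c + d) ≡ a - b + (d + (b + c))
  cancel = solve-∀
  sub-add : ∀ a b → a - b + b ≡ a
  sub-add = solve-∀

-- Finite sums and arithmetic of bivariate power series.

Σ≤-cong-≤ : ∀ n {f g} → (∀ a → a ≤ n → f a ≡ g a) → Σ≤ n f ≡ Σ≤ n g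
Σ≤-cong-≤ zero    f≗g = f≗g 0 z≤n
Σ≤-cong-≤ (suc n) f≗g =
  cong₂ _+_ (Σ≤-cong-≤ n (λ a a≤n → f≗g a (ℕ.m≤n⇒m≤1+n a≤n))) (f≗g (suc n) ℕ.≤-refl)

Σ≤-cong : ∀ n {f g} → (∀ a → f a ≡ g a) → Σ≤ n f ≡ Σ≤ n g
Σ≤-cong n f≗g = Σ≤-cong-≤ n (λ a _ → f≗g a)

Σ≤-zero : ∀ n {f} → (∀ a → f a ≡ 0ℤ) → Σ≤ n f ≡ 0ℤ
Σ≤-zero zero    f≗0 = f≗0 0
Σ≤-zero (suc n) f≗0 = cong₂ _+_ (Σ≤-zero n f≗0) (f≗0 (suc n))

Σ≤-+ : ∀ n f g → Σ≤ n (λ a → f a + g a) ≡ Σ≤ n f + Σ≤ n g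
Σ≤-+ zero    f g = refl
Σ≤-+ (suc n) f g = trans (cong (λ x → x + (f (suc n) + g (suc n))) (Σ≤-+ n f g))
  (regroup (Σ≤ n f) (Σ≤ n g) (f (suc n)) (g (suc n)))
  where
  regroup : ∀ a b c d → a + b + (c + d) ≡ a + c + (b + d)
  regroup = solve-∀

Σ≤-*ˡ : ∀ n c f → Σ≤ n (λ a → c * f a) ≡ c * Σ≤ n f
Σ≤-*ˡ zero    c f = refl
Σ≤-*ˡ (suc n) c f = trans (cong (λ x → x + c * f (suc n)) (Σ≤-*ˡ n c f))
  (sym (ℤ.*-distribˡ-+ c (Σ≤ n f) (f (suc n))))

Σ≤-head : ∀ n f → Σ≤ (suc n) f ≡ f 0 + Σ≤ n (f ∘ suc)
Σ≤-head zero    f = refl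
Σ≤-head (suc n) f =
  trans (cong (_+ f (suc (suc n))) (Σ≤-head n f)) (ℤ.+-assoc (f 0) _ _)

Σ≤-head-only : ∀ n f → (∀ a → f (suc a) ≡ 0ℤ) → Σ≤ n f ≡ f 0
Σ≤-head-only zero    f f≗0 = refl
Σ≤-head-only (suc n) f f≗0 = trans (Σ≤-head n f)
  (trans (cong (λ x → f 0 + x) (Σ≤-zero n f≗0)) (ℤ.+-identityʳ (f 0)))

infix 4 _≗₂_
_≗₂_ : PS2 → PS2 → Set
F ≗₂ G = ∀ m j → F m j ≡ G m j

⊗-congˡ : ∀ {A B} F → A ≗₂ B → A ⊗ F ≗₂ B ⊗ F
⊗-congˡ F A≗B m j = Σ≤-cong m λ a → Σ≤-cong j λ b → cong (_* F (m ∸ a) (j ∸ b)) (A≗B a b)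

⊗-congʳ-≤ : ∀ A {F G} m j → (∀ m′ j′ → m′ ≤ m → F m′ j′ ≡ G m′ j′) → (A ⊗ F) m j ≡ (A ⊗ G) m j
⊗-congʳ-≤ A m j F≗G = Σ≤-cong m λ a → Σ≤-cong j λ b →
  cong (λ x → A a b * x) (F≗G (m ∸ a) (j ∸ b) (ℕ.m∸n≤m m a))

⊗-zeroʳ : ∀ A m j → (A ⊗ λ _ _ → 0ℤ) m j ≡ 0ℤ
⊗-zeroʳ A m j = Σ≤-zero m λ a → Σ≤-zero j λ b → ℤ.*-zeroʳ (A a b)

⊗-distribˡ-⊕ : ∀ A F G → A ⊗ (F ⊕ G) ≗₂ (A ⊗ F) ⊕ (A ⊗ G)
⊗-distribˡ-⊕ A F G m j = trans
  (Σ≤-cong m λ a → trans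
    (Σ≤-cong j λ b → ℤ.*-distribˡ-+ (A a b) (F (m ∸ a) (j ∸ b)) (G (m ∸ a) (j ∸ b)))
    (Σ≤-+ j _ _))
  (Σ≤-+ m _ _)

⊗-distribʳ-⊕ : ∀ A B F → (A ⊕ B) ⊗ F ≗₂ (A ⊗ F) ⊕ (B ⊗ F)
⊗-distribʳ-⊕ A B F m j = trans
  (Σ≤-cong m λ a → trans
    (Σ≤-cong j λ b → ℤ.*-distribʳ-+ (F (m ∸ a) (j ∸ b)) (A a b) (B a b))
    (Σ≤-+ j _ _))
  (Σ≤-+ m _ _)

scale : ℤ → PS2 → PS2
scale c F m j = c * F m j

⊗-scaleʳ : ∀ A c F → A ⊗ scale c F ≗₂ scale c (A ⊗ F)
⊗-scaleʳ A c F m j = trans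
  (Σ≤-cong m λ a → trans
    (Σ≤-cong j λ b → swap (A a b) c (F (m ∸ a) (j ∸ b)))
    (Σ≤-*ˡ j c _))
  (Σ≤-*ˡ m c _)
  where
  swap : ∀ x y z → x * (y * z) ≡ y * (x * z)
  swap = solve-∀

⊗-scaleˡ : ∀ A c F → scale c A ⊗ F ≗₂ scale c (A ⊗ F)
⊗-scaleˡ A c F m j = trans
  (Σ≤-cong m λ a → trans
    (Σ≤-cong j λ b → ℤ.*-assoc c (A a b) (F (m ∸ a) (j ∸ b)))
    (Σ≤-*ˡ j c _))
  (Σ≤-*ˡ m c _)

oneS-⊗ : ∀ F → oneS ⊗ F ≗₂ F
oneS-⊗ F m j = trans (Σ≤-head-only m _ λ a → Σ≤-zero j λ b → refl)
  (trans (Σ≤-head-only j _ λ b → refl) (ℤ.*-identityˡ (F m j)))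

-- Multiplication by x, as `X-⊗` confirms.
shift : PS2 → PS2
shift F zero    j = 0ℤ
shift F (suc m) j = F m j

shift-cong : ∀ {F G} → F ≗₂ G → shift F ≗₂ shift G
shift-cong F≗G zero    j = refl
shift-cong F≗G (suc m) j = F≗G m j

shift-⊗ : ∀ A F → shift A ⊗ F ≗₂ shift (A ⊗ F)
shift-⊗ A F zero    j = Σ≤-zero j λ b → refl
shift-⊗ A F (suc m) j = trans (Σ≤-head m _)
  (trans (cong (λ x → x + (A ⊗ F) m j) (Σ≤-zero j λ b → refl)) (ℤ.+-identityˡ _))

diag-⊗ : ∀ A F → diag A ⊗ F ≗₂ diag (A ⊗ F)
diag-⊗ A F zero    j       = Σ≤-zero j λ b → refl
diag-⊗ A F (suc m) zero    = Σ≤-zero (suc m) λ { zero → refl ; (suc a) → refl }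
diag-⊗ A F (suc m) (suc j) = trans (Σ≤-head m _)
  (trans (cong₂ _+_ (Σ≤-zero (suc j) λ b → refl)
    (Σ≤-cong m λ a → trans (Σ≤-head j _) (ℤ.+-identityˡ _))) (ℤ.+-identityˡ _))

X≗ : X ≗₂ shift oneS
X≗ zero          j       = refl
X≗ (suc zero)    zero    = refl
X≗ (suc zero)    (suc j) = refl
X≗ (suc (suc m)) j       = refl

X-⊗ : ∀ F → X ⊗ F ≗₂ shift F
X-⊗ F m j = trans (⊗-congˡ F X≗ m j) (trans (shift-⊗ oneS F m j) (shift-cong (oneS-⊗ F) m j))

1-X-⊗ : ∀ F m j → ((oneS ⊖ X) ⊗ F) m j ≡ F m j - shift F m j
1-X-⊗ F m j = begin
  ((oneS ⊖ X) ⊗ F) m j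
    ≡⟨ ⊗-congˡ F (λ a b → cong (λ x → oneS a b + x) (sym (ℤ.-1*i≡-i (X a b)))) m j ⟩
  ((oneS ⊕ scale (- 1ℤ) X) ⊗ F) m j
    ≡⟨ ⊗-distribʳ-⊕ oneS (scale (- 1ℤ) X) F m j ⟩
  (oneS ⊗ F) m j + (scale (- 1ℤ) X ⊗ F) m j
    ≡⟨ cong₂ _+_ (oneS-⊗ F m j) (trans (⊗-scaleˡ X (- 1ℤ) F m j)
         (trans (ℤ.-1*i≡-i _) (cong -_ (X-⊗ F m j)))) ⟩
  F m j - shift F m j ∎

XY-⊗ : ∀ F → (X ⊗ Y) ⊗ F ≗₂ diag F
XY-⊗ F m j = begin
  ((X ⊗ Y) ⊗ F) m j        ≡⟨ ⊗-congˡ F XY≗ m j ⟩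
  (diag oneS ⊗ F) m j      ≡⟨ diag-⊗ oneS F m j ⟩
  diag (oneS ⊗ F) m j      ≡⟨ diag-cong (oneS-⊗ F) m j ⟩
  diag F m j ∎
  where
  shiftY≗ : shift Y ≗₂ diag oneS
  shiftY≗ zero          j             = refl
  shiftY≗ (suc zero)    zero          = refl
  shiftY≗ (suc zero)    (suc zero)    = refl
  shiftY≗ (suc zero)    (suc (suc j)) = refl
  shiftY≗ (suc (suc m)) zero          = refl
  shiftY≗ (suc (suc m)) (suc j)       = refl
  XY≗ : X ⊗ Y ≗₂ diag oneS
  XY≗ m j = trans (X-⊗ Y m j) (shiftY≗ m j)

-- The series c = (1 - x)/(1 - xy) and t = x c.

1/[1-XY] : PS2
1/[1-XY] = geom (X ⊗ Y)

-- The equation g = 1 + xy g in positive x-degree: the summand 1 contributes nothing there, and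
-- after one factor xy is split off, the remaining powers are exactly those that `geom` keeps at
-- degree `m`.
1/[1-XY]-suc : ∀ m j → 1/[1-XY] (suc m) j ≡ diag 1/[1-XY] (suc m) j
1/[1-XY]-suc m j = begin
  1/[1-XY] (suc m) j
    ≡⟨ Σ≤-head m _ ⟩
  0ℤ + Σ≤ m (λ n → ((X ⊗ Y) ⊗ ((X ⊗ Y) ^S n)) (suc m) j)
    ≡⟨ ℤ.+-identityˡ _ ⟩
  Σ≤ m (λ n → ((X ⊗ Y) ⊗ ((X ⊗ Y) ^S n)) (suc m) j)
    ≡⟨ Σ≤-cong m (λ n → XY-⊗ ((X ⊗ Y) ^S n) (suc m) j) ⟩
  Σ≤ m (λ n → diag ((X ⊗ Y) ^S n) (suc m) j)
    ≡⟨ row j ⟩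
  diag 1/[1-XY] (suc m) j ∎
  where
  row : ∀ j → Σ≤ m (λ n → diag ((X ⊗ Y) ^S n) (suc m) j) ≡ diag 1/[1-XY] (suc m) j
  row zero    = Σ≤-zero m λ n → refl
  row (suc j) = refl

-- `Φ f` is `c ⊗ compose f t` by definition.
c t : PS2
c = (oneS ⊖ X) ⊗ 1/[1-XY]
t = X ⊗ (oneS ⊖ X) ⊗ 1/[1-XY]

-- (1 − xy) c = 1 − x
c-equation : c ≗₂ (oneS ⊖ X) ⊕ diag c
c-equation m j = trans (1-X-⊗ 1/[1-XY] m j) (go m j)
  where
  g : PS2
  g = 1/[1-XY]
  diff : ∀ m j → c m j ≡ g m j - shift g m j
  diff = 1-X-⊗ g
  go : ∀ m j → g m j - shift g m j ≡ oneS m j - X m j + diag c m j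
  go zero j = sym (ℤ.+-identityʳ _)
  go (suc zero) zero rewrite 1/[1-XY]-suc 0 0 = refl
  go (suc (suc m)) zero rewrite 1/[1-XY]-suc (suc m) 0 | 1/[1-XY]-suc m 0 = refl
  go (suc zero) (suc j) rewrite 1/[1-XY]-suc 0 (suc j) | diff 0 j =
    sym (ℤ.+-identityˡ _)
  go (suc (suc m)) (suc j)
    rewrite 1/[1-XY]-suc (suc m) (suc j) | 1/[1-XY]-suc m (suc j) | diff (suc m) j =
    sym (ℤ.+-identityˡ _)

c-⊗ : ∀ F m j → (c ⊗ F) m j ≡ F m j - shift F m j + diag (c ⊗ F) m j
c-⊗ F m j = trans (⊗-congˡ F c-equation m j)
  (trans (⊗-distribʳ-⊕ (oneS ⊖ X) (diag c) F m j)
    (cong₂ _+_ (1-X-⊗ F m j) (diag-⊗ c F m j)))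

-- The factor 1 - xy is invertible: the equation determines each coefficient of `G` from the one
-- with both indices lowered by one.
c-⊗-unique : ∀ F G → (∀ m j → G m j ≡ F m j - shift F m j + diag G m j) → G ≗₂ c ⊗ F
c-⊗-unique F G G-eq m j = trans (G-eq m j)
  (trans (cong (λ x → F m j - shift F m j + x) (tail m j)) (sym (c-⊗ F m j)))
  where
  tail : ∀ m j → diag G m j ≡ diag (c ⊗ F) m j
  tail zero    j       = refl
  tail (suc m) zero    = refl
  tail (suc m) (suc j) = c-⊗-unique F G G-eq m j

t-⊗ : ∀ F → t ⊗ F ≗₂ shift (c ⊗ F)
t-⊗ F m j = trans (⊗-congˡ F t≗ m j) (shift-⊗ c F m j)
  where
  t≗ : t ≗₂ shift c
  t≗ m j = trans (⊗-congˡ 1/[1-XY] (X-⊗ (oneS ⊖ X)) m j) (shift-⊗ (oneS ⊖ X) 1/[1-XY] m j)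

-- Powers of t and composition with t.

t^-vanish : ∀ n {m} j → m < n → (t ^S n) m j ≡ 0ℤ
t^-vanish (suc n) {zero}  j _         = t-⊗ (t ^S n) 0 j
t^-vanish (suc n) {suc m} j (s≤s m<n) = trans (t-⊗ (t ^S n) (suc m) j)
  (trans (⊗-congʳ-≤ c m j λ m′ j′ m′≤m → t^-vanish n j′ (ℕ.≤-<-trans m′≤m m<n)) (⊗-zeroʳ c m j))

-- The cutoff in `compose` varies with the coefficient. A fixed cutoff `N` gives a finite linear
-- combination of series, over which `⊗` distributes.
partialCompose : ℕ → PS1 → PS2
partialCompose N f m j = Σ≤ N λ n → f n * (t ^S n) m j

compose-extend : ∀ d f m j → partialCompose (d ℕ.+ m) f m j ≡ compose f t m j
compose-extend zero    f m j = refl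
compose-extend (suc d) f m j = trans
  (cong₂ _+_ (compose-extend d f m j)
    (trans (cong (λ x → f (suc d ℕ.+ m) * x) (t^-vanish (suc d ℕ.+ m) j (s≤s (ℕ.m≤n+m m d))))
           (ℤ.*-zeroʳ (f (suc d ℕ.+ m)))))
  (ℤ.+-identityʳ _)

⊗-partialCompose : ∀ A N f m j →
  (A ⊗ partialCompose N f) m j ≡ Σ≤ N (λ n → f n * (A ⊗ (t ^S n)) m j)
⊗-partialCompose A zero    f m j = ⊗-scaleʳ A (f 0) oneS m j
⊗-partialCompose A (suc N) f m j = trans
  (⊗-distribˡ-⊕ A (partialCompose N f) (scale (f (suc N)) (t ^S suc N)) m j)
  (cong₂ _+_ (⊗-partialCompose A N f m j) (⊗-scaleʳ A (f (suc N)) (t ^S suc N) m j))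

-- The coefficient at `m` of the product uses only degrees up to `m`, and by `compose-extend` all of
-- these may share the cutoff `m`.
⊗-compose : ∀ A f m j → (A ⊗ compose f t) m j ≡ Σ≤ m (λ n → f n * (A ⊗ (t ^S n)) m j)
⊗-compose A f m j = trans
  (⊗-congʳ-≤ A m j λ m′ j′ m′≤m → trans (sym (compose-extend (m ∸ m′) f m′ j′))
    (cong (λ N → partialCompose N f m′ j′) (ℕ.m∸n+n≡m m′≤m)))
  (⊗-partialCompose A m f m j)

-- Uniqueness for the first-step recursion.

-- The factor c enters because an ascent following a downstep is a new one.
StepEquation : (ℕ → PS2) → Set
StepEquation F = ∀ h m j → F h m j ≡
  oneS h m * oneS 0 j + (F (suc h) m j + diag (λ h′ m′ → (c ⊗ F h′) m′ j) h m)

Triangular : (ℕ → PS2) → Set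
Triangular F = ∀ {h m} j → m < h → F h m j ≡ 0ℤ

-- A downstep lowers the x-degree and an upstep keeps it. Hence an outer induction on the degree
-- and, at fixed `m`, an upward recursion on the height, which stops above `m`, where both families
-- vanish.
StepEquation-unique : ∀ {F G} → StepEquation F → Triangular F → StepEquation G → Triangular G →
  ∀ h → F h ≗₂ G h
StepEquation-unique {F} {G} stepF triF stepG triG h m j = go m m ℕ.≤-refl h j
  where
  go : ∀ N m → m ≤ N → ∀ h j → F h m j ≡ G h m j
  go N m m≤N h j = descend (suc m) h (ℕ.m≤n+m (suc m) h)
    where
    below : ∀ N h m → m ≤ N →
      diag (λ h′ m′ → (c ⊗ F h′) m′ j) h m ≡ diag (λ h′ m′ → (c ⊗ G h′) m′ j) h m
    below N       zero    m       m≤N = refl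
    below N       (suc h) zero    m≤N = refl
    -- The product with `c` involves all degrees up to `m`, hence the strong induction through the
    -- bound `N`.
    below (suc N) (suc h) (suc m) (s≤s m≤N) =
      ⊗-congʳ-≤ c m j λ m′ j′ m′≤m → go N m′ (ℕ.≤-trans m′≤m m≤N) h j′
    -- `d` bounds the number of upsteps left until the height exceeds `m`.
    descend : ∀ d h → m < h ℕ.+ d → F h m j ≡ G h m j
    descend zero h p = trans (triF j m<h) (sym (triG j m<h))
      where
      m<h : m < h
      m<h = subst (m <_) (ℕ.+-identityʳ h) p
    descend (suc d) h p = begin
      F h m j
        ≡⟨ stepF h m j ⟩
      _ ≡⟨ cong₂ (λ x y → oneS h m * oneS 0 j + (x + y))
             (descend d (suc h) (subst (m <_) (ℕ.+-suc h d) p)) (below N h m m≤N) ⟩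
      _ ≡⟨ stepG h m j ⟨
      G h m j ∎

-- The two solutions f_h(x c) and F_h.

composed : ℕ → PS2
composed h = compose (fN h) t

fN-step : ∀ h n → fN h n ≡ oneS h n + (fN (suc h) n + diag fN h n)
fN-step h n = begin
  fN h n
    ≡⟨ trans (fN-pathTotal h n) (pathTotal-step h n (λ _ → 1ℤ)) ⟩
  oneS h n * 1ℤ + (pathTotal (suc h) n (λ _ → 1ℤ) +
                   diag (λ h n → pathTotal h n (λ _ → 1ℤ)) h n)
    ≡⟨ cong₂ _+_ (sym (ℤ.*-identityʳ (oneS h n)))
         (cong₂ _+_ (fN-pathTotal (suc h) n) (diag-cong fN-pathTotal h n)) ⟨
  oneS h n + (fN (suc h) n + diag fN h n) ∎

-- Substituting t for x in `fN-step` turns the x of a downstep into t = x c: its x is absorbed by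
-- `diag`, and its c remains as a factor of `composed h′`.
composed-step : StepEquation composed
composed-step h m j = begin
  Σ≤ m (λ n → fN h n * τ n)
    ≡⟨ Σ≤-cong m (λ n → trans (cong (_* τ n) (fN-step h n))
         (distrib (oneS h n) (fN (suc h) n) (diag fN h n) (τ n))) ⟩
  Σ≤ m (λ n → oneS h n * τ n + (fN (suc h) n * τ n + diag fN h n * τ n))
    ≡⟨ trans (Σ≤-+ m (λ n → oneS h n * τ n) _)
         (cong (λ x → Σ≤ m (λ n → oneS h n * τ n) + x)
           (Σ≤-+ m (λ n → fN (suc h) n * τ n) (λ n → diag fN h n * τ n))) ⟩
  Σ≤ m (λ n → oneS h n * τ n) +
    (composed (suc h) m j + Σ≤ m (λ n → diag fN h n * τ n))
    ≡⟨ cong₂ (λ x y → x + (composed (suc h) m j + y)) (empty h) (down h m) ⟩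
  oneS h m * oneS 0 j + (composed (suc h) m j + diag (λ h′ m′ → (c ⊗ composed h′) m′ j) h m) ∎
  where
  τ : ℕ → ℤ
  τ n = (t ^S n) m j
  distrib : ∀ a b c x → (a + (b + c)) * x ≡ a * x + (b * x + c * x)
  distrib = solve-∀
  oneS-split : ∀ m j → 1ℤ * oneS m j ≡ oneS 0 m * oneS 0 j
  oneS-split zero    j = refl
  oneS-split (suc m) j = refl
  empty : ∀ h → Σ≤ m (λ n → oneS h n * τ n) ≡ oneS h m * oneS 0 j
  empty zero    = trans (Σ≤-head-only m (λ n → oneS 0 n * τ n) (λ n → refl)) (oneS-split m j)
  empty (suc h) = Σ≤-zero m λ n → refl
  down : ∀ h m → Σ≤ m (λ n → diag fN h n * (t ^S n) m j) ≡
    diag (λ h′ m′ → (c ⊗ composed h′) m′ j) h m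
  down zero    m       = Σ≤-zero m λ n → refl
  down (suc h) zero    = refl
  down (suc h) (suc m) = begin
    Σ≤ (suc m) (λ n → diag fN (suc h) n * (t ^S n) (suc m) j)
      -- The term `n = 0` vanishes under `diag`; reindexing the others leaves one factor t to split
      -- off each power.
      ≡⟨ trans (Σ≤-head m _) (ℤ.+-identityˡ _) ⟩
    Σ≤ m (λ n → fN h n * (t ⊗ (t ^S n)) (suc m) j)
      ≡⟨ Σ≤-cong m (λ n → cong (λ x → fN h n * x) (t-⊗ (t ^S n) (suc m) j)) ⟩
    Σ≤ m (λ n → fN h n * (c ⊗ (t ^S n)) m j)
      ≡⟨ ⊗-compose c (fN h) m j ⟨
    (c ⊗ composed h) m j ∎

composed-triangular : Triangular composed
composed-triangular {h} {m} j m<h = trans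
  (Σ≤-cong-≤ m λ n n≤m → cong (_* (t ^S n) m j)
    (trans (fN-pathTotal h n) (pathTotal-vanish (λ _ → 1ℤ) (ℕ.≤-<-trans n≤m m<h))))
  (Σ≤-zero m λ n → refl)

-- As a weight on the number of counted ascents, `δ j` extracts the coefficient of y^j, so
-- `paSeries true h` is T_h and `paSeries false h` is F_h.
δ : ℕ → ℕ → ℤ
δ j a = indicator (a ≡ᵇ j)

paSeries : Bool → ℕ → PS2
paSeries b h m j = paSum b (δ j) h m

-- `paSum-zero` and `paSum-suc` give the coefficients of (1 - xy) T = (1 - x) F, which `c-⊗-unique`
-- solves for T.
paSeries-true : ∀ h → paSeries true h ≗₂ c ⊗ paSeries false h
paSeries-true h = c-⊗-unique (paSeries false h) (paSeries true h) eq
  where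
  eq : ∀ m j → paSeries true h m j ≡
    paSeries false h m j - shift (paSeries false h) m j + diag (paSeries true h) m j
  eq zero    j       = trans (paSum-zero (δ j) h)
    (sym (trans (ℤ.+-identityʳ _) (ℤ.+-identityʳ _)))
  -- `δ 0 ∘ suc` is identically 0, as a multiple of y has no y-free term; `δ (suc j) ∘ suc` computes
  -- to `δ j`.
  eq (suc m) zero    = trans (paSum-suc (δ 0) h m)
    (cong (λ x → paSeries false h (suc m) 0 - paSeries false h m 0 + x) (pathTotal-zero h m))
  eq (suc m) (suc j) = paSum-suc (δ (suc j)) h m

-- The flag of `paGo` stays `false` after `U` and becomes `true` after `D`, so the down branch is
-- `paSeries true`, which `paSeries-true` rewrites.
paSeries-step : StepEquation (paSeries false)
paSeries-step h m j = trans (pathTotal-step h m (δ j ∘ paGo false))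
  (cong₂ (λ x y → oneS h m * x + (paSeries false (suc h) m j + y)) (empty j)
    (diag-cong (λ h′ m′ → paSeries-true h′ m′ j) h m))
  where
  empty : ∀ j → indicator (0 ≡ᵇ j) ≡ oneS 0 j
  empty zero    = refl
  empty (suc j) = refl

paSeries-triangular : Triangular (paSeries false)
paSeries-triangular j m<h = pathTotal-vanish _ m<h

theorem5 : (k m j : ℕ) → Φ (fN k) m j ≡ gN k m j
theorem5 k m j = begin
  (c ⊗ composed k) m j
    ≡⟨ ⊗-congʳ-≤ c m j (λ m′ j′ _ → StepEquation-unique composed-step composed-triangular
         paSeries-step paSeries-triangular k m′ j′) ⟩
  (c ⊗ paSeries false k) m j
    ≡⟨ paSeries-true k m j ⟨
  paSeries true k m j
    ≡⟨ gN-pathTotal k m j ⟨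
  gN k m j ∎
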